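{- Let $q\ge 1$ and $n\ge 2$ be integers, let $X$ be a connected $(q+1)$-regular undirected graph with $n$ vertices and adjacency matrix $A$, and let $k\ge 1$ be an integer. Then the procedure $\mathrm{NGC}(A,k)$ (defined in the context) runs in $O(n^\omega\log k)$ time.
   Context: $\omega$ is the exponent of matrix multiplication: an $n\times n$ matrix multiplication is taken to cost $O(n^\omega)$ time. Running time counts arithmetic operations at unit cost. $\log$ is base $2$. The bound is asymptotic (uniform over $n\ge 2$ and $k\ge 2$). Procedure $\mathrm{Indices}(k)$ (integer $k\ge 1$). Start with the array $L=(k)$, indexed from $0$. While $k$ is even: set $k\leftarrow k/2$ and append $k$ to the end of $L$. Then, while $k\ne 1$: set $k\leftarrow (k+1)/2$; append $k$ to $L$; append $k-1$ to $L$; if $k$ is even, set $k\leftarrow k-1$. Return $L$. Procedure $\mathrm{NGC}(A,k)$. Let $n$ be the number of rows of $A$, $q=(\text{a row sum of }A)-1$, $L=\mathrm{Indices}(k)$, $l$ the length of $L$. Let $T[0..3]$ be an array of matrices with $T[0]\leftarrow A$ and $Q[0..3]$ an array of numbers with $Q[0]\leftarrow 1$ (other entries initially unspecified). For $i=l-1$ down to $1$ do: (a) for $j=3,2,1$ (in this order) set $Q[j]\leftarrow Q[j-1]$ and $T[j]\leftarrow T[j-1]$; (b) if $L[i-1]$ is even: put $j\leftarrow 1$ if $L[i-1]=2L[i]$ and $j\leftarrow 2$ otherwise; put $Q[0]\leftarrow Q[j]^2$ if $L[i+j-1]$ is even and $Q[0]\leftarrow q\,Q[j]^2$ otherwise;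 put $T[0]\leftarrow T[j]^2-2Q[0]I_n$, where $I_n$ is the identity matrix; (c) if $L[i-1]$ is odd: put $j\leftarrow 2$ if $L[i-1]=2L[i+1]-1$ and $j\leftarrow 1$ otherwise; put $Q[0]\leftarrow Q[j]Q[j+1]$; put $T[0]\leftarrow T[j]T[j+1]-Q[0]A$. After the loop: if $L[0]$ is odd return $\mathrm{trace}(T[0])$; otherwise return $n(q-1)+\mathrm{trace}(T[0])$. -}

module Defs where

open import Algebra.Properties.Monoid.Sum using (sum)
open import Data.Bool using (Bool; true; false; if_then_else_)
open import Data.Fin using (Fin; zero; suc; inject₁; toℕ; _≟_)
open import Data.Fin.Subset using (∣_∣)
open import Data.Integer using (+_)
import Data.Integer as ℤ
open import Data.List using (List; []; _∷_; _∷ʳ_; length)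
open import Data.Nat using (ℕ; zero; suc; _+_; _*_; _∸_; _^_; _≤_; _<_; _≡ᵇ_; _%_; ⌊_/2⌋; ⌈_/2⌉)
open import Data.Nat.Induction using (Acc; acc; <-wellFounded)
open import Data.Nat.Properties using (⌊n/2⌋<n; ⌈n/2⌉<n; m∸n≤m; ≤-<-trans)
open import Data.Product using (∃; _×_; _,_)
open import Data.Rational using (ℚ; 0ℚ; 1ℚ; ↥_; ↧ₙ_)
import Data.Rational as ℚ
open import Data.Rational.Properties using (+-0-monoid)
open import Data.Sum using (_⊎_)
open import Data.Unit using (⊤; tt)
open import Data.Vec using (Vec; []; _∷_; lookup; tabulate; _[_]≔_)
import Data.Vec.Functional as Vector
open import Function using (_∘_)
open import Relation.Binary.Construct.Closure.ReflexiveTransitive using (Star)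
open import Relation.Binary.PropositionalEquality using (_≡_)
open import Relation.Nullary using (¬_; does)

------------------------------------------------------------------------
-- Real exponents and asymptotic bounds

-- A nonnegative real number, as a Dedekind cut: `Lower s` says that s is
-- strictly below the number, `Upper s` that s is strictly above it.
record ℝ≥0 : Set₁ where
  field
    Lower Upper   : ℚ → Set
    nonnegative   : ∀ {s} → s ℚ.< 0ℚ → Lower s
    upper-bounded : ∃ Upper
    lower-closed  : ∀ {s t} → s ℚ.< t → Lower t → Lower s
    lower-open    : ∀ {s} → Lower s → ∃ λ t → s ℚ.< t × Lower t
    upper-closed  : ∀ {s t} → s ℚ.< t → Upper s → Upper t
    upper-open    : ∀ {t} → Upper t → ∃ λ s → s ℚ.< t × Upper s
    disjoint      : ∀ {s} → ¬ (Lower s × Upper s)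
    located       : ∀ {s t} → s ℚ.< t → Lower s ⊎ Upper t

open ℝ≥0 public using (Upper)

-- `t ≤[ c · n ^ ω ]` means t ≤ c · n^ω, for n ≥ 1.  Since n^ω is the
-- infimum of n^(p/r) over the rationals p/r > ω, this holds iff
-- t ≤ c · n^(p/r), that is t^r ≤ c^r · n^p, for all of them.  Every
-- rational above a nonnegative real is nonnegative, so ∣ ↥ s ∣ is its
-- numerator.
_≤[_·_^_] : ℕ → ℕ → ℕ → ℝ≥0 → Set
t ≤[ c · n ^ ω ] =
  ∀ s → Upper ω s → t ^ (↧ₙ s) ≤ c ^ (↧ₙ s) * n ^ ℤ.∣ ↥ s ∣

-- `t ≤[ c · n ^ ω ·log₂ k ]` means t ≤ c · n^ω · log₂ k, for n, k ≥ 1.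
-- As log₂ k is the infimum of the rationals a/b above it, and
-- log₂ k < a/b iff k^b < 2^a, this holds iff b · t ≤ (c · a) · n^ω
-- for all such a and b.
_≤[_·_^_·log₂_] : ℕ → ℕ → ℕ → ℝ≥0 → ℕ → Set
t ≤[ c · n ^ ω ·log₂ k ] =
  ∀ a b → k ^ b < 2 ^ a → (b * t) ≤[ (c * a) · n ^ ω ]

------------------------------------------------------------------------
-- Computations with a running time

record Timed (A : Set) : Set where
  constructor _after_
  field
    value : A
    time  : ℕ

open Timed public

private
  variable
    A : Set
    m n g : ℕ

return : A → Timed A
return x = x after 0

_>>=_ : {B : Set} → Timed A → (A → Timed B) → Timed B
x >>= f = value (f (value x)) after (time x + time (f (value x)))

_>>_ : {B : Set} → Timed A → Timed B → Timed B
x >> y = x >>= λ _ → y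

-- Every unit-cost step is charged through `tick` or `op`.  Besides the
-- arithmetic operations (on matrix entries, on k and on array indices),
-- tests and accesses to or assignments of array entries are charged, a
-- matrix being copied entry by entry.
tick : ℕ → Timed ⊤
tick c = tt after c

op : A → Timed A
op x = x after 1

------------------------------------------------------------------------
-- Matrices

Matrix : ℕ → Set
Matrix n = Fin n → Fin n → ℚ

_·_ : Matrix n → Matrix n → Matrix n
(M · N) i j = sum +-0-monoid λ r → M i r ℚ.* N r j

-- Operations on rational numbers

_⊕_ _⊖_ _⊗_ : ℚ → ℚ → Timed ℚ
x ⊕ y = op (x ℚ.+ y)
x ⊖ y = op (x ℚ.- y)
x ⊗ y = op (x ℚ.* y)

-- Operations on vectors and matrices

each : (Fin n → Timed A) → Timed (Fin n → A)
each {zero}  f = return Vector.[]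
each {suc n} f = do
  x  ← f zero
  xs ← each (f ∘ suc)
  return (x Vector.∷ xs)

sumᵀ : (Fin n → ℚ) → Timed ℚ
sumᵀ {zero}  v = return 0ℚ
sumᵀ {suc n} v = do
  s ← sumᵀ (v ∘ suc)
  v zero ⊕ s

trace : Matrix n → Timed ℚ
trace M = sumᵀ λ i → M i i

entrywise : (Fin n → Fin n → Timed ℚ) → Timed (Matrix n)
entrywise f = each λ i → each (f i)

copy : Matrix n → Timed (Matrix n)
copy M = entrywise λ i j → op (M i j)

scale : ℚ → Matrix n → Timed (Matrix n)
scale c M = entrywise λ i j → c ⊗ M i j

subtract : Matrix n → Matrix n → Timed (Matrix n)
subtract M N = entrywise λ i j → M i j ⊖ N i j

I : Matrix n
I i j = if does (i ≟ j) then 1ℚ else 0ℚ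

------------------------------------------------------------------------
-- Matrix multiplication algorithms

-- As usual for the exponent of matrix multiplication, algorithms for a
-- given n are straight-line programs over the entries of the two factors,
-- here with rational constants.  Divisions by nonconstants are left out:
-- they can be eliminated at the expense of a constant factor.

-- An operand in a program that has executed g steps.
data Operand (n g : ℕ) : Set where
  left right : Fin n → Fin n → Operand n g
  constant   : ℚ → Operand n g
  result     : Fin g → Operand n g

data Operation : Set where
  add sub mul : Operation

data Program (n : ℕ) : ℕ → Set where
  output : (Fin n → Fin n → Operand n g) → Program n g
  step   : Operation → Operand n g → Operand n g → Program n (suc g) → Program n g

fetch : Matrix n → Matrix n → Vec ℚ g → Operand n g → ℚ
fetch M N ρ (left i j)   = M i j
fetch M N ρ (right i j)  = N i j
fetch M N ρ (constant c) = c
fetch M N ρ (result x)   = lookup ρ x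

perform : Operation → ℚ → ℚ → Timed ℚ
perform add = _⊕_
perform sub = _⊖_
perform mul = _⊗_

-- The most recent result is at the head of ρ.
run : Program n g → Matrix n → Matrix n → Vec ℚ g → Timed (Matrix n)
run (output f)     M N ρ = return λ i j → fetch M N ρ (f i j)
run (step o x y P) M N ρ = do
  z ← perform o (fetch M N ρ x) (fetch M N ρ y)
  run P M N (z ∷ ρ)

record MatrixMultiplication : Set where
  field
    program : ∀ n → Program n 0
    correct : ∀ n (M N : Matrix n) i j →
              value (run (program n) M N []) i j ≡ (M · N) i j

open MatrixMultiplication public using (program)

multiply : MatrixMultiplication → Matrix n → Matrix n → Timed (Matrix n)
multiply μ M N = run (program μ _) M N []

_RunsInO[n^_] : MatrixMultiplication → ℝ≥0 → Set
μ RunsInO[n^ ω ] =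
  ∃ λ c → ∀ n → 1 ≤ n → (M N : Matrix n) → time (multiply μ M N) ≤[ c · n ^ ω ]

------------------------------------------------------------------------
-- Graphs

record Graph (n : ℕ) : Set where
  field
    edge        : Fin n → Fin n → Bool
    symmetric   : ∀ i j → edge i j ≡ edge j i
    irreflexive : ∀ i → edge i i ≡ false

open Graph public using (edge)

Connected : Graph n → Set
Connected X = ∀ i j → Star (λ u v → edge X u v ≡ true) i j

degree : Graph n → Fin n → ℕ
degree X i = ∣ tabulate (edge X i) ∣

Regular : ℕ → Graph n → Set
Regular d X = ∀ i → degree X i ≡ d

adjacency : Graph n → Matrix n
adjacency X i j = if edge X i j then 1ℚ else 0ℚ

------------------------------------------------------------------------
-- The procedure Indices

isEven : ℕ → Bool
isEven k = k % 2 ≡ᵇ 0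

-- The two loops recurse along the order of ℕ, as the new value of k must be
-- known to be smaller; hence their steps are charged by `tick`.  The clauses
-- for k = 0 are never reached from k ≥ 1.

-- while k is even
halving : ∀ k → Acc _<_ k → List ℕ → Timed (ℕ × List ℕ)
halving zero    _        L = return (zero , L)
halving (suc k) (acc rs) L = do
  even ← op (isEven (suc k))
  if even
    then (do tick 2 -- halve, append
             halving ⌊ suc k /2⌋ (rs (⌊n/2⌋<n k)) (L ∷ʳ ⌊ suc k /2⌋))
    else return (suc k , L)

-- while k ≠ 1
descending : ∀ k → Acc _<_ k → List ℕ → Timed (List ℕ)
descending zero          _        L = return L
descending (suc zero)    _        L = do
  tick 1 -- test k ≠ 1
  return L
descending (suc (suc k)) (acc rs) L = do
  tick 6 -- test k ≠ 1, increment, halve, append, decrement, append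
  let k′ = ⌈ suc (suc k) /2⌉   -- (k + 1) / 2, k being odd here
      L′ = (L ∷ʳ k′) ∷ʳ (k′ ∸ 1)
  even ← op (isEven k′)
  if even
    then (do tick 1 -- decrement
             descending (k′ ∸ 1) (rs (≤-<-trans (m∸n≤m k′ 1) (⌈n/2⌉<n k))) L′)
    else descending k′ (rs (⌈n/2⌉<n k)) L′

Indices : ℕ → Timed (List ℕ)
Indices k = do
  L        ← op (k ∷ [])
  (k′ , L) ← halving k (<-wellFounded k) L
  descending k′ (<-wellFounded k′) L

------------------------------------------------------------------------
-- The procedure NGC

-- L[i]; NGC never reads outside of the array.
_‼_ : List ℕ → ℕ → ℕ
[]      ‼ i     = 0
(x ∷ L) ‼ zero  = x
(x ∷ L) ‼ suc i = L ‼ i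

shift : (A → Timed A) → Vec A 4 → Timed (Vec A 4)
shift assign (x₀ ∷ x₁ ∷ x₂ ∷ _ ∷ []) = do
  y₃ ← assign x₂
  y₂ ← assign x₁
  y₁ ← assign x₀
  return (x₀ ∷ y₁ ∷ y₂ ∷ y₃ ∷ [])

record State (n : ℕ) : Set where
  constructor state
  field
    T : Vec (Matrix n) 4
    Q : Vec ℚ 4

2ℚ : ℚ
2ℚ = + 2 ℚ./ 1

module _ (μ : MatrixMultiplication) {n : ℕ} (A : Matrix n) (q : ℚ) (L : List ℕ) where

  -- In both of the following j ranges over {1, 2} ⊆ Fin 3; `inject₁ j` and
  -- `suc j` are j and j + 1 as indices of T and Q.

  evenCase : (i : ℕ) → (L[i-1] : ℕ) → State n → Timed (State n)
  evenCase i L[i-1] (state T Q) = do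
    L[i]     ← op (L ‼ i)
    2L[i]    ← op (2 * L[i])
    doubled  ← op (L[i-1] ≡ᵇ 2L[i])
    j        ← op {A = Fin 3} (if doubled then suc zero else suc (suc zero))
    i+j      ← op (i + toℕ j)
    i+j-1    ← op (i+j ∸ 1)
    L[i+j-1] ← op (L ‼ i+j-1)
    even     ← op (isEven L[i+j-1])
    Q[j]²    ← lookup Q (inject₁ j) ⊗ lookup Q (inject₁ j)
    Q₀       ← if even then return Q[j]² else q ⊗ Q[j]²
    tick 1 -- assign Q[0]
    T[j]²    ← multiply μ (lookup T (inject₁ j)) (lookup T (inject₁ j))
    2Q₀      ← 2ℚ ⊗ Q₀
    2Q₀I     ← scale 2Q₀ I
    T₀       ← subtract T[j]² 2Q₀I
    T₀       ← copy T₀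
    return (state (T [ zero ]≔ T₀) (Q [ zero ]≔ Q₀))

  oddCase : (i : ℕ) → (L[i-1] : ℕ) → State n → Timed (State n)
  oddCase i L[i-1] (state T Q) = do
    i+1       ← op (i + 1)
    L[i+1]    ← op (L ‼ i+1)
    2L[i+1]   ← op (2 * L[i+1])
    2L[i+1]-1 ← op (2L[i+1] ∸ 1)
    match     ← op (L[i-1] ≡ᵇ 2L[i+1]-1)
    j         ← op {A = Fin 3} (if match then suc (suc zero) else suc zero)
    j+1       ← op (suc j)
    Q₀        ← lookup Q (inject₁ j) ⊗ lookup Q j+1
    tick 1 -- assign Q[0]
    T[j]T[j+1] ← multiply μ (lookup T (inject₁ j)) (lookup T j+1)
    Q₀A       ← scale Q₀ A
    T₀        ← subtract T[j]T[j+1] Q₀A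
    T₀        ← copy T₀
    return (state (T [ zero ]≔ T₀) (Q [ zero ]≔ Q₀))

  body : ℕ → State n → Timed (State n)
  body i (state T Q) = do
    Q      ← shift op Q
    T      ← shift copy T
    i-1    ← op (i ∸ 1)
    L[i-1] ← op (L ‼ i-1)
    even   ← op (isEven L[i-1])
    if even
      then evenCase i L[i-1] (state T Q)
      else oddCase i L[i-1] (state T Q)

  -- for i = m down to 1
  loop : (m : ℕ) → State n → Timed (State n)
  loop zero    s = do
    tick 1 -- test i ≥ 1
    return s
  loop (suc m) s = do
    s ← body (suc m) s
    tick 2 -- test i ≥ 1, decrement i
    loop m s

-- q is obtained from the row sum of A with index r.  The entries 1, 2, 3 of
-- T and Q, initially unspecified, are filled with zeros without charge; they
-- are not read before being overwritten with specified values.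
NGC : MatrixMultiplication → Fin n → Matrix n → ℕ → Timed ℚ
NGC {n} μ r A k = do
  rowSum ← sumᵀ (A r)
  q      ← rowSum ⊖ 1ℚ
  L      ← Indices k
  l      ← op (length L)
  T₀     ← copy A
  Q₀     ← op 1ℚ
  l-1    ← op (l ∸ 1)
  let O = λ _ _ → 0ℚ
  state T Q ← loop μ A q L l-1 (state (T₀ ∷ O ∷ O ∷ O ∷ []) (Q₀ ∷ 0ℚ ∷ 0ℚ ∷ 0ℚ ∷ []))
  L[0]   ← op (L ‼ 0)
  even   ← op (isEven L[0])
  tr     ← trace (lookup T zero)
  if even
    then (do q-1    ← q ⊖ 1ℚ
             n[q-1] ← (+ n ℚ./ 1) ⊗ q-1
             n[q-1] ⊕ tr)
    else return tr

{-# OPTIONS --safe #-}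
module Submission where

-- With 2^m between k and 2k, the array L has at most 3m + 1 entries, so NGC
-- makes O(log k) passes through its loop, each with one matrix multiplication
-- and O(n²) further operations.  The latter are absorbed by the former: the n²
-- entries of a product are distinct, nonconstant and different from the entries
-- of the factors, so a program that multiplies matrices has at least n² steps.

open import Defs
open import Algebra.Properties.Monoid.Sum using (sum; sum-replicate-zero; sum-cong-≗)
open import Data.Bool using (Bool; true; false; if_then_else_)
open import Data.Fin using (Fin; zero; suc; toℕ; combine; remQuot; _≟_)
open import Data.Fin.Properties using (injective⇒≤; combine-remQuot)
import Data.Integer as ℤ
open import Data.List using (List; []; _∷_; _∷ʳ_; length)
open import Data.List.Properties using (length-++)
open import Data.Nat using (ℕ; zero; suc; _+_; _*_; _∸_; _^_; _≤_; _<_; _≤?_; _≡ᵇ_; z≤n; s≤s; ⌊_/2⌋; ⌈_/2⌉)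
open import Data.Nat.Induction using (Acc; acc; <-wellFounded)
open import Data.Nat.Properties
  using ( ≤-refl; ≤-reflexive; ≤-trans; <⇒≤; <⇒≱; ≰⇒>; n≤1+n; m≤n⇒m≤1+n; m≤m+n; m≤n+m; m∸n≤m; ∸-monoˡ-≤
        ; module ≤-Reasoning; +-suc; +-comm; +-identityʳ; +-mono-≤; +-monoˡ-≤; +-monoʳ-≤
        ; *-assoc; *-identityʳ; *-monoˡ-≤; *-monoʳ-≤
        ; m^n>0; ^-distribˡ-+-*; ^-*-assoc; ^-monoˡ-≤; ^-monoʳ-≤; ^-monoʳ-<
        ; ⌈n/2⌉-mono; ⌊n/2⌋≤⌈n/2⌉; n≡⌈n+n/2⌉ )
open import Data.Nat.Tactic.RingSolver using (solve-∀)
open import Data.Product using (∃; _×_; _,_; proj₁; proj₂)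
open import Data.Rational using (ℚ; 0ℚ; 1ℚ)
import Data.Rational as ℚ
open import Data.Rational.Properties using (+-0-monoid)
  renaming (+-identityʳ to ℚ+-identityʳ; *-zeroˡ to ℚ*-zeroˡ; *-zeroʳ to ℚ*-zeroʳ)
open import Data.Vec using (Vec; []; _∷_)
open import Function using (_∘_)
open import Relation.Binary.PropositionalEquality using (_≡_; refl; sym; trans; cong; cong₂; subst; module ≡-Reasoning)
open import Relation.Nullary using (¬_; yes; no; contradiction)

private
  variable
    n g : ℕ

-- Programs for matrix multiplication

-- The `g` steps executed before are included, which makes this the length of the memory when the
-- program stops.
totalSteps : Program n g → ℕ
totalSteps {g = g} (output f)     = g
totalSteps         (step o x y P) = totalSteps P

outputs : (P : Program n g) → Fin n → Fin n → Operand n (totalSteps P)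
outputs (output f)     = f
outputs (step o x y P) = outputs P

finalMemory : (P : Program n g) → Matrix n → Matrix n → Vec ℚ g → Vec ℚ (totalSteps P)
finalMemory (output f)     M N ρ = ρ
finalMemory (step o x y P) M N ρ =
  finalMemory P M N (value (perform o (fetch M N ρ x) (fetch M N ρ y)) ∷ ρ)

value-run : (P : Program n g) (M N : Matrix n) (ρ : Vec ℚ g) → ∀ i j →
            value (run P M N ρ) i j ≡ fetch M N (finalMemory P M N ρ) (outputs P i j)
value-run (output f)     M N ρ i j = refl
value-run (step o x y P) M N ρ i j = value-run P M N _ i j

time-perform : ∀ o x y → time (perform o x y) ≡ 1
time-perform add x y = refl
time-perform sub x y = refl
time-perform mul x y = refl

-- A program has no branches and each step costs 1, so its time is the same for all inputs.
time-run : (P : Program n g) (M N : Matrix n) (ρ : Vec ℚ g) →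
           time (run P M N ρ) + g ≡ totalSteps P
time-run         (output f)     M N ρ = refl
time-run {g = g} (step o x y P) M N ρ
  rewrite time-perform o (fetch M N ρ x) (fetch M N ρ y) =
  trans (sym (+-suc _ g)) (time-run P M N _)

-- Test matrices: zero products and outer products

zeros : Matrix n
zeros _ _ = 0ℚ

columnMatrix rowMatrix : (Fin n → ℚ) → Matrix n
columnMatrix u i zero    = u i
columnMatrix u i (suc _) = 0ℚ
rowMatrix v zero    j = v j
rowMatrix v (suc _) j = 0ℚ

sum-0 : (v : Fin n → ℚ) → (∀ i → v i ≡ 0ℚ) → sum +-0-monoid v ≡ 0ℚ
sum-0 {n} v v≡0 = trans (sum-cong-≗ +-0-monoid v≡0) (sum-replicate-zero +-0-monoid n)

zeros-· : (M : Matrix n) → ∀ i j → (zeros · M) i j ≡ 0ℚ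
zeros-· M i j = sum-0 _ λ r → ℚ*-zeroˡ (M r j)

·-zeros : (M : Matrix n) → ∀ i j → (M · zeros) i j ≡ 0ℚ
·-zeros M i j = sum-0 _ λ r → ℚ*-zeroʳ (M i r)

-- Only the summation index `zero` contributes; every other term is `0ℚ ℚ.* 0ℚ`, which evaluates to
-- `0ℚ`.
column·row : (u v : Fin n → ℚ) → ∀ i j → (columnMatrix u · rowMatrix v) i j ≡ u i ℚ.* v j
column·row {suc n} u v i j =
  trans (cong (u i ℚ.* v j ℚ.+_) (sum-0 {n} (λ _ → 0ℚ) λ _ → refl)) (ℚ+-identityʳ _)

I-diagonal : (i : Fin n) → I i i ≡ 1ℚ
I-diagonal i with i ≟ i
... | yes _  = refl
... | no i≢i = contradiction refl i≢i

I-nonzero : (i j : Fin n) → ¬ (I i j ≡ 0ℚ) → i ≡ j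
I-nonzero i j I≢0 with i ≟ j
... | yes i≡j = i≡j
... | no _    = contradiction refl I≢0

1ℚ≢0ℚ : ¬ (1ℚ ≡ 0ℚ)
1ℚ≢0ℚ ()

product-nonzero : ∀ x y → x ℚ.* y ≡ 1ℚ → ¬ (x ≡ 0ℚ) × ¬ (y ≡ 0ℚ)
product-nonzero x y xy≡1 =
  (λ { refl → 1ℚ≢0ℚ (trans (sym xy≡1) (ℚ*-zeroˡ y)) }) ,
  (λ { refl → 1ℚ≢0ℚ (trans (sym xy≡1) (ℚ*-zeroʳ x)) })

-- Multiplication programs have at least n² steps

module _ (μ : MatrixMultiplication) (n : ℕ) where

  private
    P = program μ n

  size : ℕ
  size = totalSteps P

  time-multiply : (M N : Matrix n) → time (multiply μ M N) ≡ size
  time-multiply M N = trans (sym (+-identityʳ _)) (time-run P M N [])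

  fetch-outputs : (M N : Matrix n) → ∀ i j →
                  fetch M N (finalMemory P M N []) (outputs P i j) ≡ (M · N) i j
  fetch-outputs M N i j =
    trans (sym (value-run P M N [] i j)) (MatrixMultiplication.correct μ n M N i j)

  -- An entry of one factor can be 1 while the other factor, and hence the product, is zero. A
  -- constant cannot serve both a product entry 0 and a product entry 1.
  outputs-computed : ∀ i j → ∃ λ x → outputs P i j ≡ result x
  outputs-computed i j with outputs P i j in eq
  ... | result x   = x , refl
  ... | left a b   = contradiction
    (trans (sym (cong (fetch ones zeros _) eq))
           (trans (fetch-outputs ones zeros i j) (·-zeros ones i j))) 1ℚ≢0ℚ
    where ones = λ _ _ → 1ℚ
  ... | right a b  = contradiction
    (trans (sym (cong (fetch zeros ones _) eq))
           (trans (fetch-outputs zeros ones i j) (zeros-· ones i j))) 1ℚ≢0ℚ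
    where ones = λ _ _ → 1ℚ
  ... | constant c = contradiction (trans (sym c≡1) c≡0) 1ℚ≢0ℚ
    where
    1s = λ _ → 1ℚ
    c≡0 : c ≡ 0ℚ
    c≡0 = trans (sym (cong (fetch zeros zeros _) eq))
                (trans (fetch-outputs zeros zeros i j) (zeros-· zeros i j))
    c≡1 : c ≡ 1ℚ
    c≡1 = trans (sym (cong (fetch (columnMatrix 1s) (rowMatrix 1s) _) eq))
                (trans (fetch-outputs _ _ i j) (column·row 1s 1s i j))

  -- The product of column i of I by row j of I is the matrix unit at (i , j).
  outputs-injective : ∀ i j i′ j′ → outputs P i j ≡ outputs P i′ j′ → i ≡ i′ × j ≡ j′
  outputs-injective i j i′ j′ eq =
    let p , q = product-nonzero (I i i′) (I j j′) unit
    in I-nonzero i i′ p , I-nonzero j j′ q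
    where
    M = columnMatrix (I i)
    N = rowMatrix (I j)
    open ≡-Reasoning
    unit : I i i′ ℚ.* I j j′ ≡ 1ℚ
    unit = begin
      I i i′ ℚ.* I j j′                                   ≡⟨ column·row (I i) (I j) i′ j′ ⟨
      (M · N) i′ j′                                       ≡⟨ fetch-outputs M N i′ j′ ⟨
      fetch M N (finalMemory P M N []) (outputs P i′ j′)  ≡⟨ cong (fetch M N _) eq ⟨
      fetch M N (finalMemory P M N []) (outputs P i j)    ≡⟨ fetch-outputs M N i j ⟩
      (M · N) i j                                         ≡⟨ column·row (I i) (I j) i j ⟩
      I i i ℚ.* I j j                                     ≡⟨ cong₂ ℚ._*_ (I-diagonal i) (I-diagonal j) ⟩
      1ℚ                                                  ∎

  -- Pigeonhole: distinct entries of the product sit at distinct addresses of the final memory.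
  n*n≤size : n * n ≤ size
  n*n≤size = injective⇒≤ {f = address} address-injective
    where
    address : Fin (n * n) → Fin size
    address x = let i , j = remQuot n x in proj₁ (outputs-computed i j)

    address-injective : ∀ {x y} → address x ≡ address y → x ≡ y
    address-injective {x} {y} eq = begin
      x                      ≡⟨ combine-remQuot {n} n x ⟨
      combine i j            ≡⟨ cong₂ combine (proj₁ same) (proj₂ same) ⟩
      combine i′ j′          ≡⟨ combine-remQuot {n} n y ⟩
      y                      ∎
      where
      open ≡-Reasoning
      i  = proj₁ (remQuot {n} n x)
      j  = proj₂ (remQuot {n} n x)
      i′ = proj₁ (remQuot {n} n y)
      j′ = proj₂ (remQuot {n} n y)
      same : i ≡ i′ × j ≡ j′
      same = outputs-injective i j i′ j′
        (trans (proj₂ (outputs-computed i j))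
               (trans (cong result eq) (sym (proj₂ (outputs-computed i′ j′)))))

-- The procedure Indices

-- Lets a conditional be bounded by a common bound on its branches, without a case split on the
-- test.
if-intro : {A : Set} (R : A → Set) (b : Bool) {x y : A} → R x → R y → R (if b then x else y)
if-intro R true  r s = r
if-intro R false r s = s

length-∷ʳ : {A : Set} (xs : List A) (x : A) → length (xs ∷ʳ x) ≡ length xs + 1
length-∷ʳ xs x = length-++ xs

k≤2m⇒⌈k/2⌉≤m : ∀ {k m} → k ≤ 2 * m → ⌈ k /2⌉ ≤ m
k≤2m⇒⌈k/2⌉≤m {k} {m} k≤2m = begin
  ⌈ k /2⌉           ≤⟨ ⌈n/2⌉-mono k≤2m ⟩
  ⌈ m + (m + 0) /2⌉ ≡⟨ cong (λ x → ⌈ m + x /2⌉) (+-identityʳ m) ⟩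
  ⌈ m + m /2⌉       ≡⟨ n≡⌈n+n/2⌉ m ⟨
  m                 ∎
  where open ≤-Reasoning

-- Each pass lowers the exponent `m` by one, costs 3 and appends one entry; the extra 1 pays for the
-- test that ends the loop. The bound on the final `k` is what the second loop starts from.
halving-bound : ∀ m k (a : Acc _<_ k) L → k ≤ 2 ^ m →
  let r = halving k a L in
  time r ≤ 1 + 3 * m × proj₁ (value r) ≤ 2 ^ m × length (proj₂ (value r)) ≤ length L + m
halving-bound m zero a L k≤ = z≤n , z≤n , m≤m+n _ m
halving-bound zero (suc zero) (acc rs) L k≤ = ≤-refl , ≤-refl , m≤m+n _ 0
halving-bound zero (suc (suc k)) a L (s≤s ())
halving-bound (suc m) (suc k) (acc rs) L k≤ with isEven (suc k)
... | false = s≤s z≤n , k≤ , m≤m+n _ (suc m)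
... | true  =
  let h        = ⌊ suc k /2⌋
      t , v , l = halving-bound m h (rs _) (L ∷ʳ h)
                    (≤-trans (⌊n/2⌋≤⌈n/2⌉ (suc k)) (k≤2m⇒⌈k/2⌉≤m k≤))
  in (begin
       3 + time (halving h (rs _) (L ∷ʳ h)) ≤⟨ +-monoʳ-≤ 3 t ⟩
       3 + (1 + 3 * m)                      ≡⟨ lemma₁ m ⟩
       1 + 3 * suc m                        ∎)
   , ≤-trans v (^-monoʳ-≤ 2 (n≤1+n m))
   , (begin
       length (proj₂ (value (halving h (rs _) (L ∷ʳ h)))) ≤⟨ l ⟩
       length (L ∷ʳ h) + m ≡⟨ cong (_+ m) (length-∷ʳ L h) ⟩
       length L + 1 + m    ≡⟨ lemma₂ (length L) m ⟩
       length L + suc m    ∎)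
  where
  open ≤-Reasoning
  lemma₁ : ∀ m → 3 + (1 + 3 * m) ≡ 1 + 3 * suc m
  lemma₁ = solve-∀
  lemma₂ : ∀ x m → x + 1 + m ≡ x + suc m
  lemma₂ = solve-∀

-- Whether or not it is decremented, the new `k` is at most half the old one rounded up, so `m`
-- drops by one. A pass costs at most 8 and appends two entries.
descending-bound : ∀ m k (a : Acc _<_ k) L → k ≤ 2 ^ m →
  let r = descending k a L in
  time r ≤ 1 + 8 * m × length (value r) ≤ length L + 2 * m
descending-bound m zero       a L k≤ = z≤n , m≤m+n _ (2 * m)
descending-bound m (suc zero) a L k≤ = s≤s z≤n , m≤m+n _ (2 * m)
descending-bound zero (suc (suc k)) a L (s≤s ())
descending-bound (suc m) (suc (suc k)) (acc rs) L k≤ =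
  let k′ = ⌈ suc (suc k) /2⌉
      L′ = (L ∷ʳ k′) ∷ʳ (k′ ∸ 1)
      k′≤ = k≤2m⇒⌈k/2⌉≤m k≤
      t₁ , l₁ = descending-bound m (k′ ∸ 1) (rs _) L′ (≤-trans (m∸n≤m k′ 1) k′≤)
      t₂ , l₂ = descending-bound m k′ (rs _) L′ k′≤
      -- The even branch pays 1 more for its decrement; the odd branch is weakened to match.
      t , l = if-intro (λ r → time r ≤ 2 + 8 * m × length (value r) ≤ length L′ + 2 * m)
                (isEven k′) (s≤s t₁ , l₁) (m≤n⇒m≤1+n t₂ , l₂)
  in ≤-trans (+-monoʳ-≤ 7 t) (≤-reflexive (lemma₁ m))
   , ≤-trans l (≤-reflexive (begin
       length L′ + 2 * m       ≡⟨ cong (_+ 2 * m) (length-∷ʳ (L ∷ʳ k′) (k′ ∸ 1)) ⟩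
       length (L ∷ʳ k′) + 1 + 2 * m ≡⟨ cong (λ x → x + 1 + 2 * m) (length-∷ʳ L k′) ⟩
       length L + 1 + 1 + 2 * m ≡⟨ lemma₂ (length L) m ⟩
       length L + 2 * suc m    ∎))
  where
  open ≡-Reasoning
  lemma₁ : ∀ m → 7 + (2 + 8 * m) ≡ 1 + 8 * suc m
  lemma₁ = solve-∀
  lemma₂ : ∀ x m → x + 1 + 1 + 2 * m ≡ x + 2 * suc m
  lemma₂ = solve-∀

-- Each loop is charged as if it had all of the exponent `m` to itself.
Indices-bound : ∀ m k → k ≤ 2 ^ m →
  time (Indices k) ≤ 3 + 11 * m × length (value (Indices k)) ≤ 1 + 3 * m
Indices-bound m k k≤ =
  let t₁ , v , l₁ = halving-bound m k (<-wellFounded k) (k ∷ []) k≤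
      t₂ , l₂     = descending-bound m _ (<-wellFounded _) _ v
  in ≤-trans (s≤s (+-mono-≤ t₁ t₂)) (≤-reflexive (lemma₁ m))
   , ≤-trans l₂ (≤-trans (+-monoˡ-≤ (2 * m) l₁) (≤-reflexive (lemma₂ m)))
  where
  lemma₁ : ∀ m → 1 + ((1 + 3 * m) + (1 + 8 * m)) ≡ 3 + 11 * m
  lemma₁ = solve-∀
  lemma₂ : ∀ m → 1 + m + 2 * m ≡ 1 + 3 * m
  lemma₂ = solve-∀

-- The procedure NGC

time-each : {A : Set} (f : Fin n → Timed A) {t : ℕ} → (∀ i → time (f i) ≡ t) →
            time (each f) ≡ n * t
time-each {zero}  f f≡t = refl
time-each {suc n} f {t} f≡t = cong₂ _+_ (f≡t zero)
  (trans (+-identityʳ _) (time-each (f ∘ suc) (f≡t ∘ suc)))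

time-entrywise : (f : Fin n → Fin n → Timed ℚ) → (∀ i j → time (f i j) ≡ 1) →
                 time (entrywise f) ≡ n * n
time-entrywise {n} f f≡1 = time-each _ λ i →
  trans (time-each (f i) (f≡1 i)) (*-identityʳ n)

time-sumᵀ : (v : Fin n → ℚ) → time (sumᵀ v) ≡ n
time-sumᵀ {zero}  v = refl
time-sumᵀ {suc n} v = trans (cong (_+ 1) (time-sumᵀ (v ∘ suc))) (+-comm n 1)

module _ (μ : MatrixMultiplication) {n : ℕ} (1≤n : 1 ≤ n) where

  private
    -- The cost of one multiplication, in which all other costs are measured from here on.
    t = size μ n

    n≤n*n : n ≤ n * n
    n≤n*n = subst (_≤ n * n) (*-identityʳ n) (*-monoʳ-≤ n 1≤n)

    n≤t : n ≤ t
    n≤t = ≤-trans n≤n*n (n*n≤size μ n)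

    constant≤ : ∀ c → c ≤ c * t
    constant≤ c = subst (_≤ c * t) (*-identityʳ c) (*-monoʳ-≤ c (≤-trans 1≤n n≤t))

    -- The lower bound on program size absorbs the n² scalar operations into one multiplication.
    entrywise≤ : {f : Fin n → Fin n → ℚ} → time (entrywise λ i j → op (f i j)) ≤ t
    entrywise≤ {f} = ≤-trans (≤-reflexive (time-entrywise (λ i j → op (f i j)) λ _ _ → refl)) (n*n≤size μ n)

    multiply≤ : (M N : Matrix n) → time (multiply μ M N) ≤ t
    multiply≤ M N = ≤-reflexive (time-multiply μ n M N)

    sumᵀ≤ : (v : Fin n → ℚ) → time (sumᵀ v) ≤ t
    sumᵀ≤ v = ≤-trans (≤-reflexive (time-sumᵀ v)) n≤t

  module _ (A : Matrix n) (q : ℚ) (L : List ℕ) where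

    evenCase-bound : ∀ i x s → time (evenCase μ A q L i x s) ≤ 12 + 4 * t
    evenCase-bound i x s =
      -- 9 counts the eight index operations and the squaring of `Q[j]`. The remaining 3 are the
      -- possible factor `q`, the assignment of `Q[0]` and its doubling; the four `t` are multiply,
      -- scale, subtract and copy.
      +-monoʳ-≤ 9 (≤-trans
        (+-mono-≤ (if-intro (λ r → time r ≤ 1) (isEven (L ‼ (i + toℕ j ∸ 1))) z≤n ≤-refl)
          (s≤s (+-mono-≤ (multiply≤ _ _) (s≤s (+-mono-≤ entrywise≤
            (+-mono-≤ entrywise≤ (+-mono-≤ entrywise≤ (z≤n {0}))))))))
        (≤-reflexive (lemma t)))
      where
      j : Fin 3
      j = if x ≡ᵇ 2 * (L ‼ i) then suc zero else suc (suc zero)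
      lemma : ∀ t → 1 + suc (t + suc (t + (t + (t + 0)))) ≡ 3 + 4 * t
      lemma = solve-∀

    oddCase-bound : ∀ i x s → time (oddCase μ A q L i x s) ≤ 12 + 4 * t
    oddCase-bound i x s =
      +-monoʳ-≤ 9 (≤-trans
        (+-mono-≤ (multiply≤ _ _) (+-mono-≤ entrywise≤
            (+-mono-≤ entrywise≤ (+-mono-≤ entrywise≤ (z≤n {0})))))
        -- The odd case costs only 9 + 4t; a slack of 3 gives both cases the same bound.
        (≤-trans (≤-reflexive (lemma t)) (m≤n+m (4 * t) 3)))
      where
      lemma : ∀ t → t + (t + (t + (t + 0))) ≡ 4 * t
      lemma = solve-∀

    body-bound : ∀ i s → time (body μ A q L i s) ≤ 25 * t
    -- The vectors are split into their entries so that `shift` evaluates.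
    body-bound i (state (T₀ ∷ T₁ ∷ T₂ ∷ T₃ ∷ []) (Q₀ ∷ Q₁ ∷ Q₂ ∷ Q₃ ∷ [])) = begin
      _ ≤⟨ +-monoʳ-≤ 3 (+-mono-≤
             (+-mono-≤ entrywise≤ (+-mono-≤ entrywise≤ (+-mono-≤ entrywise≤ (z≤n {0}))))
             (+-monoʳ-≤ 3 (if-intro (λ r → time r ≤ 12 + 4 * t) (isEven (L ‼ (i ∸ 1)))
               (evenCase-bound i (L ‼ (i ∸ 1)) s) (oddCase-bound i (L ‼ (i ∸ 1)) s)))) ⟩
      3 + ((t + (t + (t + 0))) + (3 + (12 + 4 * t))) ≡⟨ lemma₁ t ⟩
      18 + 7 * t       ≤⟨ +-monoˡ-≤ (7 * t) (constant≤ 18) ⟩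
      18 * t + 7 * t   ≡⟨ lemma₂ t ⟩
      25 * t           ∎
      where
      open ≤-Reasoning
      s = state (value (shift copy (T₀ ∷ T₁ ∷ T₂ ∷ T₃ ∷ [])))
                (value (shift op (Q₀ ∷ Q₁ ∷ Q₂ ∷ Q₃ ∷ [])))
      lemma₁ : ∀ t → 3 + ((t + (t + (t + 0))) + (3 + (12 + 4 * t))) ≡ 18 + 7 * t
      lemma₁ = solve-∀
      lemma₂ : ∀ t → 18 * t + 7 * t ≡ 25 * t
      lemma₂ = solve-∀

    loop-bound : ∀ m s → time (loop μ A q L m s) ≤ 1 + m * (27 * t)
    loop-bound zero    s = ≤-refl
    loop-bound (suc m) s = begin
      _ ≤⟨ +-mono-≤ (body-bound (suc m) s) (+-monoʳ-≤ 2 (loop-bound m _)) ⟩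
      25 * t + (2 + (1 + m * (27 * t)))     ≤⟨ +-monoʳ-≤ (25 * t) (+-monoˡ-≤ _ (constant≤ 2)) ⟩
      25 * t + (2 * t + (1 + m * (27 * t))) ≡⟨ lemma t m ⟩
      1 + suc m * (27 * t)                  ∎
      where
      open ≤-Reasoning
      lemma : ∀ t m → 25 * t + (2 * t + (1 + m * (27 * t))) ≡ 1 + suc m * (27 * t)
      lemma = solve-∀

  NGC-bound : ∀ r (A : Matrix n) m k → k ≤ 2 ^ m → time (NGC μ r A k) ≤ 92 * ((1 + m) * t)
  NGC-bound r A m k k≤ = begin
    _ ≤⟨ +-mono-≤ (sumᵀ≤ (A r)) (s≤s (+-mono-≤ (proj₁ Indices≤) (s≤s (+-mono-≤ entrywise≤
           (+-monoʳ-≤ 2 (+-mono-≤ loop≤ (+-monoʳ-≤ 2 (+-mono-≤ (sumᵀ≤ _)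
             (if-intro (λ r → time r ≤ 3) (isEven (value (Indices k) ‼ 0)) ≤-refl z≤n))))))))) ⟩
    t + suc ((3 + 11 * m) + suc (t + (2 + ((1 + 3 * m * (27 * t)) + (2 + (t + 3))))))
      ≡⟨ lemma₁ t m ⟩
    13 + 11 * m + (3 * t + 81 * m * t)
      ≤⟨ +-monoˡ-≤ _ (+-mono-≤ (constant≤ 13) (constant≤ (11 * m))) ⟩
    13 * t + 11 * m * t + (3 * t + 81 * m * t)
      -- The coefficient of `m * t` is 11 + 81 = 92, that of `t` only 13 + 3 = 16; adding 76 makes
      -- them equal.
      ≤⟨ m≤m+n _ (76 * t) ⟩
    13 * t + 11 * m * t + (3 * t + 81 * m * t) + 76 * t
      ≡⟨ lemma₂ t m ⟩
    92 * ((1 + m) * t) ∎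
    where
    open ≤-Reasoning
    Indices≤ = Indices-bound m k k≤
    loop≤ : ∀ {q s} → time (loop μ A q (value (Indices k)) (length (value (Indices k)) ∸ 1) s)
                      ≤ 1 + 3 * m * (27 * t)
    loop≤ {q} {s} = ≤-trans (loop-bound A q (value (Indices k)) (length (value (Indices k)) ∸ 1) s)
      -- The loop starts at l - 1, so the initial entry of `L` costs no pass.
      (s≤s (*-monoˡ-≤ (27 * t) (∸-monoˡ-≤ 1 (proj₂ Indices≤))))
    lemma₁ : ∀ t m →
      t + suc ((3 + 11 * m) + suc (t + (2 + ((1 + 3 * m * (27 * t)) + (2 + (t + 3))))))
      ≡ 13 + 11 * m + (3 * t + 81 * m * t)
    lemma₁ = solve-∀
    lemma₂ : ∀ t m →
      13 * t + 11 * m * t + (3 * t + 81 * m * t) + 76 * t ≡ 92 * ((1 + m) * t)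
    lemma₂ = solve-∀

-- Logarithms and powers

-- Going from one `k` to the next, `m` is kept as long as 2^m is large enough and otherwise raised
-- by one. In the latter case 2^m is below the new `k`, so doubling it stays within twice that `k`.
ceilingLog₂ : ∀ k → 1 ≤ k → ∃ λ m → k ≤ 2 ^ m × 2 ^ m ≤ 2 * k
ceilingLog₂ (suc zero)    _ = 0 , ≤-refl , s≤s z≤n
ceilingLog₂ (suc (suc k)) _ with ceilingLog₂ (suc k) (s≤s z≤n)
... | m , k≤ , ≤2k with suc (suc k) ≤? 2 ^ m
...   | yes p = m , p , ≤-trans ≤2k (*-monoʳ-≤ 2 (n≤1+n (suc k)))
...   | no ¬p = suc m
              , ≤-trans (+-mono-≤ (m^n>0 2 m) k≤) (+-monoʳ-≤ (2 ^ m) (m≤m+n _ 0))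
              , *-monoʳ-≤ 2 (<⇒≤ (≰⇒> ¬p))

2^-cancel-≤ : ∀ {m n} → 2 ^ m ≤ 2 ^ n → m ≤ n
2^-cancel-≤ {m} {n} p with m ≤? n
... | yes m≤n = m≤n
... | no m≰n  = contradiction p (<⇒≱ (^-monoʳ-< 2 (s≤s (s≤s z≤n)) (≰⇒> m≰n)))

*-^-distrib : ∀ x y r → (x * y) ^ r ≡ x ^ r * y ^ r
*-^-distrib x y zero    = refl
*-^-distrib x y (suc r) = trans (cong (x * y *_) (*-^-distrib x y r)) (lemma x y (x ^ r) (y ^ r))
  where
  lemma : ∀ x y u v → x * y * (u * v) ≡ x * u * (y * v)
  lemma = solve-∀

-- This is 1 + m ≤ 3 log₂ k, tested against a rational a/b above log₂ k. It combines m ≤ 1 + log₂ k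
-- with 1 ≤ log₂ k, the latter from `2 ≤ k`.
log₂-bound : ∀ {k m a b} → 2 ≤ k → 2 ^ m ≤ 2 * k → k ^ b < 2 ^ a → b * (1 + m) ≤ 3 * a
log₂-bound {k} {m} {a} {b} 2≤k 2^m≤2k k^b<2^a = begin
  b * (1 + m)     ≡⟨ lemma₁ b m ⟩
  b + m * b       ≤⟨ +-mono-≤ b≤a (2^-cancel-≤ 2^mb≤) ⟩
  a + (b + a)     ≤⟨ +-monoʳ-≤ a (+-monoˡ-≤ a b≤a) ⟩
  a + (a + a)     ≡⟨ lemma₂ a ⟩
  3 * a           ∎
  where
  open ≤-Reasoning
  b≤a : b ≤ a
  b≤a = 2^-cancel-≤ (≤-trans (^-monoˡ-≤ b 2≤k) (<⇒≤ k^b<2^a))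
  2^mb≤ : 2 ^ (m * b) ≤ 2 ^ (b + a)
  2^mb≤ = begin
    2 ^ (m * b)    ≡⟨ ^-*-assoc 2 m b ⟨
    (2 ^ m) ^ b    ≤⟨ ^-monoˡ-≤ b 2^m≤2k ⟩
    (2 * k) ^ b    ≡⟨ *-^-distrib 2 k b ⟩
    2 ^ b * k ^ b  ≤⟨ *-monoʳ-≤ (2 ^ b) (<⇒≤ k^b<2^a) ⟩
    2 ^ b * 2 ^ a  ≡⟨ ^-distribˡ-+-* 2 b a ⟨
    2 ^ (b + a)    ∎
  lemma₁ : ∀ b m → b * (1 + m) ≡ b + m * b
  lemma₁ = solve-∀
  lemma₂ : ∀ a → a + (a + a) ≡ 3 * a
  lemma₂ = solve-∀

-- For an exponent p/r above ω, raising to the power r yields a factor d^r, which merges with c^r.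
≤[]-scale : ∀ {ω t c n} d {u} → u ≤ d * t → t ≤[ c · n ^ ω ] → u ≤[ (d * c) · n ^ ω ]
≤[]-scale {t = t} {c} {n} d {u} u≤dt t≤ s ω<s = begin
  u ^ r                      ≤⟨ ^-monoˡ-≤ r u≤dt ⟩
  (d * t) ^ r                ≡⟨ *-^-distrib d t r ⟩
  d ^ r * t ^ r              ≤⟨ *-monoʳ-≤ (d ^ r) (t≤ s ω<s) ⟩
  d ^ r * (c ^ r * n ^ p)    ≡⟨ *-assoc (d ^ r) (c ^ r) (n ^ p) ⟨
  d ^ r * c ^ r * n ^ p      ≡⟨ cong (_* n ^ p) (*-^-distrib d c r) ⟨
  (d * c) ^ r * n ^ p        ∎
  where
  open ≤-Reasoning
  r = ℚ.↧ₙ s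
  p = ℤ.∣ ℚ.↥ s ∣

theorem2p5 : (ω : ℝ≥0) (μ : MatrixMultiplication) → μ RunsInO[n^ ω ] →
    ∃ λ (c : ℕ) →
    (q n : ℕ) → 1 ≤ q → 2 ≤ n →
    (X : Graph n) → Connected X → Regular (suc q) X →
    (k : ℕ) → 2 ≤ k →
    (r : Fin n) →
    time (NGC μ r (adjacency X) k) ≤[ c · n ^ ω ·log₂ k ]
-- 276 = 92 · 3, with 92 from `NGC-bound` and 3 from `log₂-bound`.
theorem2p5 ω μ (c , fast) = 276 * c , bound
  where
  bound : (q n : ℕ) → 1 ≤ q → 2 ≤ n →
    (X : Graph n) → Connected X → Regular (suc q) X →
    (k : ℕ) → 2 ≤ k → (r : Fin n) →
    time (NGC μ r (adjacency X) k) ≤[ 276 * c · n ^ ω ·log₂ k ]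
  bound _ n _ 2≤n X _ _ k 2≤k r a b k^b<2^a =
    subst (λ C → (b * time (NGC μ r (adjacency X) k)) ≤[ C · n ^ ω ]) (lemma₃ a c)
      (≤[]-scale {ω} (276 * a) bt≤
        -- The time of a multiplication does not depend on the factors, so any pair reveals
        -- `size μ n`.
        (subst (λ T → T ≤[ c · n ^ ω ]) (time-multiply μ n zeros zeros)
          (fast n 1≤n zeros zeros)))
    where
    1≤n = <⇒≤ 2≤n
    log = ceilingLog₂ k (<⇒≤ 2≤k)
    m = proj₁ log
    open ≤-Reasoning
    lemma₁ : ∀ b m t → b * (92 * ((1 + m) * t)) ≡ 92 * (b * (1 + m)) * t
    lemma₁ = solve-∀
    lemma₂ : ∀ a t → 92 * (3 * a) * t ≡ 276 * a * t
    lemma₂ = solve-∀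
    lemma₃ : ∀ a c → 276 * a * c ≡ 276 * c * a
    lemma₃ = solve-∀
    bt≤ : b * time (NGC μ r (adjacency X) k) ≤ 276 * a * size μ n
    bt≤ = begin
      b * time (NGC μ r (adjacency X) k) ≤⟨ *-monoʳ-≤ b (NGC-bound μ 1≤n r (adjacency X) m k (proj₁ (proj₂ log))) ⟩
      b * (92 * ((1 + m) * size μ n))    ≡⟨ lemma₁ b m (size μ n) ⟩
      92 * (b * (1 + m)) * size μ n      ≤⟨ *-monoˡ-≤ (size μ n) (*-monoʳ-≤ 92 (log₂-bound {k} {m} {a} {b} 2≤k (proj₂ (proj₂ log)) k^b<2^a)) ⟩
      92 * (3 * a) * size μ n            ≡⟨ lemma₂ a (size μ n) ⟩
      276 * a * size μ n                 ∎
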